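{- Let $\mathcal{R}_1, \mathcal{R}_2$ be families of ranges and let $k,m$ be positive integers. Suppose that we have hitting $k$-cliques with respect to $\mathcal{R}_1$ and hitting $k$-cliques with respect to $\mathcal{R}_2$ (for these $k,m$). Then for $\mathcal{R} = \mathcal{R}_1 \cup \mathcal{R}_2$ it holds that $m_{\mathcal{R}}(k) \leq m$.
   Context: For a finite set $V \subset \mathbb{R}^2$ and a family $\mathcal{R}$ of subsets of $\mathbb{R}^2$ (ranges), $\mathcal{H}(V,\mathcal{R},m)$ is the hypergraph on $V$ whose hyperedges are the sets $V \cap R$, $R \in \mathcal{R}$, of size exactly $m$. A coloring $c\colon V \to [k]$ is polychromatic if every hyperedge contains a vertex of each of the $k$ colors. Point sets are in general position (pairwise distinct $x$-coordinates, $y$-coordinates, and values $x+y$). $m_{\mathcal{R}}(k)$ is the smallest $m$ such that for every finite $V \subset \mathbb{R}^2$ in general position, $\mathcal{H}(V,\mathcal{R},m)$ admits a polychromatic $k$-coloring ($\infty$ if none exists). For fixed $k,m,\mathcal{R}$ we say we have hitting $k$-cliques if for every finite $V \subset \mathbb{R}^2$ there exist pairwise disjoint $k$-element subsets of $V$ such that every hyperedge of $\mathcal{H}(V,\mathcal{R},m)$ fully contains at least one of these subsets. -}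

module Defs where

open import Data.Fin using (Fin)
open import Data.Fin.Subset using (Subset; _∈_; _⊆_; _∩_; ∣_∣; Empty)
open import Data.List.Relation.Unary.All using (All)
open import Data.List.Relation.Unary.AllPairs using (AllPairs)
open import Data.List.Relation.Unary.Any using (Any)
open import Data.Nat as ℕ using (ℕ)
import Data.Nat.Properties as ℕ
open import Data.Product using (∃-syntax; _×_; _,_; proj₁; proj₂)
open import Data.Product.Relation.Binary.Pointwise.NonDependent using (×-setoid)
open import Data.Rational as ℚ using (ℚ; 0ℚ; ½)
import Data.Rational.Properties as ℚ
open import Data.Rational.Solver using (module +-*-Solver)
open import Function using (_∘_; _⇔_)
open import Function.Definitions using (Injective)
open import Level using (Level; suc; _⊔_; 0ℓ)
open import Relation.Binary using (Setoid; Rel; _Respects_)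
open import Relation.Binary.PropositionalEquality using (_≡_; refl; sym; trans; cong; subst)
open import Relation.Nullary using (¬_)
open import Relation.Nullary.Construct.Add.Supremum using (_⁺; ⊤⁺; [_])
open import Relation.Binary.Construct.Add.Supremum.NonStrict ℕ._≤_ using (_≤⁺_)
open import Relation.Unary using (Pred)

private variable
  r ℓ : Level

------------------------------------------------------------------------
-- The real numbers: Cauchy sequences of rationals, two of them being
-- equal when their difference tends to 0.

IsCauchy : (ℕ → ℚ) → Set
IsCauchy x = ∀ ε → 0ℚ ℚ.< ε →
  ∃[ N ] (∀ m n → N ℕ.≤ m → N ℕ.≤ n → ℚ.∣ x m ℚ.- x n ∣ ℚ.< ε)

record ℝ : Set where
  constructor mkℝ
  field
    seq    : ℕ → ℚ
    cauchy : IsCauchy seq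

open ℝ public

infix 4 _≃_

_≃_ : Rel ℝ 0ℓ
x ≃ y = ∀ ε → 0ℚ ℚ.< ε →
  ∃[ N ] (∀ n → N ℕ.≤ n → ℚ.∣ seq x n ℚ.- seq y n ∣ ℚ.< ε)

private
  half-pos : ∀ {ε} → 0ℚ ℚ.< ε → 0ℚ ℚ.< ½ ℚ.* ε
  half-pos {ε} 0<ε = subst (ℚ._< ½ ℚ.* ε) (ℚ.*-zeroʳ ½) (ℚ.*-monoʳ-<-pos ½ 0<ε)

  half+half : ∀ ε → ½ ℚ.* ε ℚ.+ ½ ℚ.* ε ≡ ε
  half+half ε = trans (sym (ℚ.*-distribʳ-+ ε ½ ½)) (ℚ.*-identityˡ ε)

  ∣+∣<ε : ∀ {ε p q s} → s ≡ p ℚ.+ q →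
          ℚ.∣ p ∣ ℚ.< ½ ℚ.* ε → ℚ.∣ q ∣ ℚ.< ½ ℚ.* ε → ℚ.∣ s ∣ ℚ.< ε
  ∣+∣<ε {ε} {p} {q} refl p< q< = ℚ.≤-<-trans (ℚ.∣p+q∣≤∣p∣+∣q∣ p q)
    (subst (ℚ.∣ p ∣ ℚ.+ ℚ.∣ q ∣ ℚ.<_) (half+half ε) (ℚ.+-mono-< p< q<))

  interchange : ∀ a b c d →
    (a ℚ.+ b) ℚ.- (c ℚ.+ d) ≡ (a ℚ.- c) ℚ.+ (b ℚ.- d)
  interchange = solve 4
    (λ a b c d → (a :+ b) :- (c :+ d) := (a :- c) :+ (b :- d)) refl
    where open +-*-Solver

  telescope : ∀ a b c → a ℚ.- c ≡ (a ℚ.- b) ℚ.+ (b ℚ.- c)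
  telescope = solve 3 (λ a b c → a :- c := (a :- b) :+ (b :- c)) refl
    where open +-*-Solver

  ∣-∣-swap : ∀ a b → ℚ.∣ a ℚ.- b ∣ ≡ ℚ.∣ b ℚ.- a ∣
  ∣-∣-swap a b = trans (sym (ℚ.∣-p∣≡∣p∣ (a ℚ.- b)))
    (cong ℚ.∣_∣ (solve 2 (λ x y → :- (x :- y) := y :- x) refl a b))
    where open +-*-Solver

infixl 6 _+_

_+_ : ℝ → ℝ → ℝ
x + y = mkℝ (λ n → seq x n ℚ.+ seq y n) λ ε 0<ε →
  let N₁ , h₁ = cauchy x (½ ℚ.* ε) (half-pos 0<ε)
      N₂ , h₂ = cauchy y (½ ℚ.* ε) (half-pos 0<ε)
  in N₁ ℕ.⊔ N₂ , λ m n N≤m N≤n →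
     ∣+∣<ε (interchange (seq x m) (seq y m) (seq x n) (seq y n))
       (h₁ m n (ℕ.m⊔n≤o⇒m≤o N₁ N₂ N≤m) (ℕ.m⊔n≤o⇒m≤o N₁ N₂ N≤n))
       (h₂ m n (ℕ.m⊔n≤o⇒n≤o N₁ N₂ N≤m) (ℕ.m⊔n≤o⇒n≤o N₁ N₂ N≤n))

ℝ-setoid : Setoid 0ℓ 0ℓ
ℝ-setoid = record
  { Carrier = ℝ
  ; _≈_ = _≃_
  ; isEquivalence = record
    { refl = λ {x} ε 0<ε → 0 , λ n _ →
        subst (ℚ._< ε) (cong ℚ.∣_∣ (sym (ℚ.+-inverseʳ (seq x n)))) 0<ε
    ; sym = λ {x} {y} x≃y ε 0<ε →
        let N , h = x≃y ε 0<ε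
        in N , λ n N≤n → subst (ℚ._< ε) (∣-∣-swap (seq x n) (seq y n)) (h n N≤n)
    ; trans = λ {x} {y} {z} x≃y y≃z ε 0<ε →
        let N₁ , h₁ = x≃y (½ ℚ.* ε) (half-pos 0<ε)
            N₂ , h₂ = y≃z (½ ℚ.* ε) (half-pos 0<ε)
        in N₁ ℕ.⊔ N₂ , λ n N≤n →
           ∣+∣<ε (telescope (seq x n) (seq y n) (seq z n))
             (h₁ n (ℕ.m⊔n≤o⇒m≤o N₁ N₂ N≤n))
             (h₂ n (ℕ.m⊔n≤o⇒n≤o N₁ N₂ N≤n))
    }
  }

ℝ²-setoid : Setoid 0ℓ 0ℓ
ℝ²-setoid = ×-setoid ℝ-setoid ℝ-setoid

open Setoid ℝ²-setoid public using () renaming (Carrier to ℝ²; _≈_ to _≃²_)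

------------------------------------------------------------------------
-- Finite point sets

-- A finite V ⊂ ℝ² is given by an enumeration without repetition; subsets
-- and colorings of V are then subsets and colorings of Fin size.
record PointSet : Set where
  field
    size     : ℕ
    point    : Fin size → ℝ²
    distinct : Injective _≡_ _≃²_ point

open PointSet public

record GeneralPosition (V : PointSet) : Set where
  field
    x-distinct   : Injective _≡_ _≃_ (proj₁ ∘ point V)
    y-distinct   : Injective _≡_ _≃_ (proj₂ ∘ point V)
    x+y-distinct : Injective _≡_ _≃_ (λ i → proj₁ (point V i) + proj₂ (point V i))

------------------------------------------------------------------------
-- Ranges and the hypergraph 𝓗(V,𝓡,m)

record Range r : Set (suc r) where
  field
    Contains : Pred ℝ² r
    resp     : Contains Respects _≃²_

open Range public

Family : ∀ r ℓ → Set (suc r ⊔ suc ℓ)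
Family r ℓ = Pred (Range r) ℓ

-- E is the trace V ∩ R.
IsTrace : (V : PointSet) → Range r → Subset (size V) → Set r
IsTrace V R E = ∀ i → i ∈ E ⇔ Contains R (point V i)

IsHyperedge : (V : PointSet) → Family r ℓ → ℕ → Subset (size V) → Set (suc r ⊔ ℓ)
IsHyperedge V 𝓡 m E = ∃[ R ] 𝓡 R × IsTrace V R E × ∣ E ∣ ≡ m

------------------------------------------------------------------------
-- Polychromatic colorings

IsPolychromatic : (V : PointSet) → Family r ℓ → (m k : ℕ) →
                  (Fin (size V) → Fin k) → Set (suc r ⊔ ℓ)
IsPolychromatic V 𝓡 m k c =
  ∀ E → IsHyperedge V 𝓡 m E → ∀ color → ∃[ i ] i ∈ E × c i ≡ color

PolychromaticallyColorable : Family r ℓ → (k m : ℕ) → Set (suc r ⊔ ℓ)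
PolychromaticallyColorable 𝓡 k m =
  ∀ V → GeneralPosition V → ∃[ c ] IsPolychromatic V 𝓡 m k c

-- M ∈ ℕ ∪ {∞} is the value m_𝓡(k), with ⊤⁺ for ∞.
IsPolychromaticNumber : Family r ℓ → ℕ → ℕ ⁺ → Set (suc r ⊔ ℓ)
IsPolychromaticNumber 𝓡 k [ M ] =
  PolychromaticallyColorable 𝓡 k M ×
  (∀ m → PolychromaticallyColorable 𝓡 k m → M ℕ.≤ m)
IsPolychromaticNumber 𝓡 k ⊤⁺ = ∀ m → ¬ PolychromaticallyColorable 𝓡 k m

-- m_𝓡(k) ≤ m.  Constructively a minimum of a nonempty but undecidable set
-- of naturals need not exist, so `bounds` alone could hold for want of a
-- value M; `attained` excludes this.  Classically the two are equivalent.
record PolychromaticNumber≤ (𝓡 : Family r ℓ) (k m : ℕ) : Set (suc r ⊔ ℓ) where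
  field
    attained : ∃[ m′ ] m′ ℕ.≤ m × PolychromaticallyColorable 𝓡 k m′
    bounds   : ∀ M → IsPolychromaticNumber 𝓡 k M → M ≤⁺ [ m ]

------------------------------------------------------------------------
-- Hitting cliques

Disjoint : ∀ {n} → Rel (Subset n) 0ℓ
Disjoint K L = Empty (K ∩ L)

-- V ranges over all finite point sets here, not only those in general position.
HittingCliques : Family r ℓ → (k m : ℕ) → Set (suc r ⊔ ℓ)
HittingCliques 𝓡 k m = ∀ V → ∃[ Ks ]
  All (λ K → ∣ K ∣ ≡ k) Ks ×
  AllPairs Disjoint Ks ×
  (∀ E → IsHyperedge V 𝓡 m E → Any (_⊆ E) Ks)

{-# OPTIONS --safe #-}
module Submission where

-- Each point lies in at most one clique of either family, so the points are the
-- edges of a bipartite multigraph of maximum degree ≤ k whose vertices are the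
-- cliques.  König's edge coloring theorem gives a k-coloring injective on every
-- clique, hence showing all k colors on it.  Points are colored one at a time:
-- if the new point misses α in its first clique and β in its second, all points
-- colored α or β, together with the new one, form paths and even cycles, and
-- recoloring these alternately with α and β leaves the coloring proper.

open import Defs
open import Algebra.Definitions using (Involutive)
open import Data.Bool using (Bool; true; false; not; if_then_else_)
open import Data.Bool.Properties using (not-injective; not-¬)
open import Data.Fin using (Fin; zero; suc; toℕ; combine; opposite; fromℕ<; punchOut)
open import Data.Fin.Properties
  using (_≟_; any?; all?; toℕ-injective; combine-injective; opposite-involutive;
         suc-injective; injective⇒≤; punchOut-injective)
open import Data.Fin.Subset using (Subset; _∈_; _⊆_; ∣_∣)
open import Data.Fin.Subset.Properties using (_∈?_; x∈p∩q⁺)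
open import Data.List using (List; []; _∷_; allFin; cartesianProduct)
open import Data.List.Membership.Propositional using (find; lose) renaming (_∈_ to _∈ᴸ_)
open import Data.List.Membership.Propositional.Properties
  using (∈-allFin; ∈-cartesianProduct⁺)
open import Data.List.Relation.Unary.All as All using (All)
open import Data.List.Relation.Unary.AllPairs using (AllPairs; _∷_)
open import Data.List.Relation.Unary.Any as Any using (Any; here; there)
open import Data.Nat as ℕ using (ℕ; NonZero; _<?_)
import Data.Nat.Properties as ℕ
open import Data.Product using (∃; ∃-syntax; _×_; _,_; proj₁; proj₂; swap)
open import Data.Product.Properties using (≡-dec)
open import Data.Sum using (_⊎_; inj₁; inj₂)
open import Data.Vec using (_∷_; here; there)
open import Function using (_∘_; id; case_of_)
open import Function.Definitions using (Injective)
open import Level using (0ℓ)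
open import Relation.Binary
  using (Rel; Decidable; DecidableEquality; Symmetric; Transitive; tri<; tri≈; tri>)
open import Relation.Binary.Construct.Add.Supremum.NonStrict ℕ._≤_ using ([_])
open import Relation.Binary.PropositionalEquality
  using (_≡_; _≢_; refl; sym; trans; cong; subst)
open import Relation.Nullary using (¬_; Dec; yes; no; does; contradiction)
open import Relation.Nullary.Construct.Add.Supremum using (⊤⁺; [_])
open import Relation.Nullary.Decidable
  using (dec-true; dec-false; decidable-stable; ¬?; _×-dec_; _⊎-dec_)
open import Relation.Unary using (_∪_)

private variable
  A B : Set
  n k : ℕ

-- Functions updated at two points, and involutions

≢-resp : {p p′ q q′ : A} → p ≡ p′ → q ≡ q′ → p′ ≢ q′ → p ≢ q
≢-resp refl refl p≢q = p≢q

involutive⇒injective : (τ : A → A) → Involutive _≡_ τ → Injective _≡_ _≡_ τ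
involutive⇒injective τ inv {a} {b} eq =
  trans (sym (inv a)) (trans (cong τ eq) (inv b))

module _ (_≟A_ : DecidableEquality A) where

  update₂ : A → B → A → B → (A → B) → A → B
  update₂ x p y q f a =
    if does (a ≟A x) then p else if does (a ≟A y) then q else f a

  module _ {x y : A} {p q : B} (f : A → B) where

    update₂-fst : update₂ x p y q f x ≡ p
    update₂-fst rewrite dec-true (x ≟A x) refl = refl

    update₂-snd : y ≢ x → update₂ x p y q f y ≡ q
    update₂-snd y≢x rewrite dec-false (y ≟A x) y≢x | dec-true (y ≟A y) refl = refl

    update₂-other : ∀ {a} → a ≢ x → a ≢ y → update₂ x p y q f a ≡ f a
    update₂-other {a} a≢x a≢y
      rewrite dec-false (a ≟A x) a≢x | dec-false (a ≟A y) a≢y = refl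

  transpose : A → A → A → A
  transpose x y = update₂ x y y x id

  transpose-involutive : ∀ {x y} → y ≢ x → Involutive _≡_ (transpose x y)
  transpose-involutive {x} {y} y≢x a with a ≟A x | a ≟A y
  ... | yes refl | _        = update₂-snd id y≢x
  ... | no _     | yes refl = update₂-fst id
  ... | no a≢x   | no a≢y   = update₂-other id a≢x a≢y

  -- Two-colorings separating the pairs of two involutions

  module _ (code : A → ℕ) (code-injective : Injective _≡_ _≡_ code)
           (σ : A → A) (σ-inv : Involutive _≡_ σ) where

    -- For a pair {x , σ x} not matched by τ, let τ match x with σ x and τ x
    -- with τ (σ x) instead; a coloring separating the new pairs separates the
    -- old ones and {x , σ x} once x and σ x are recolored.
    separate : (xs : List A) {τ : A → A} → Involutive _≡_ τ → (∀ a → τ a ≢ a) →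
      ∃ λ (b : A → Bool) → (∀ a → b a ≢ b (τ a)) ×
        (∀ {a} → a ∈ᴸ xs → σ a ≢ a → b a ≢ b (σ a))
    separate [] {τ} τ-inv τ-free = b , b-τ , λ ()
      where
      b : A → Bool
      -- Each pair of `τ` is oriented by `code`; as `τ` has no fixed points, exactly one of its two
      -- elements gets `true`.
      b a = does (code a <? code (τ a))

      b-τ : ∀ a → b a ≢ b (τ a)
      b-τ a eq with ℕ.<-cmp (code a) (code (τ a))
      ... | tri< lt _ ≯ = case trans (sym (dec-true (_ <? _) lt))
              (trans eq (dec-false (_ <? _) (≯ ∘ subst (λ a′ → code (τ a) ℕ.< code a′) (τ-inv a)))) of λ ()
      ... | tri≈ _ e _ = τ-free a (sym (code-injective e))
      ... | tri> ≮ _ gt = case trans (sym (dec-false (_ <? _) ≮))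
              (trans eq (dec-true (_ <? _) (subst (λ a′ → code (τ a) ℕ.< code a′) (sym (τ-inv a)) gt))) of λ ()
    separate (x ∷ xs) {τ} τ-inv τ-free with σ x ≟A x | τ x ≟A σ x
    ... | yes fixed | _ = let b , b-τ , b-σ = separate xs τ-inv τ-free in
      b , b-τ , λ where
        (here refl) moved → contradiction fixed moved
        (there a∈) → b-σ a∈
    ... | no _ | yes matched = let b , b-τ , b-σ = separate xs τ-inv τ-free in
      b , b-τ , λ where
        (here refl) _ → ≢-resp refl (cong b (sym matched)) (b-τ x)
        (there a∈) → b-σ a∈
    ... | no y≢x | no u≢y = b , b-τ , b-σ
      where
      y u v : A
      y = σ x
      u = τ x
      v = τ y

      τ-injective : Injective _≡_ _≡_ τ
      τ-injective = involutive⇒injective τ τ-inv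

      v≢x : v ≢ x
      v≢x v≡x = u≢y (trans (cong τ (sym v≡x)) (τ-inv y))

      v≢u : v ≢ u
      v≢u = y≢x ∘ τ-injective

      w τ′ : A → A
      -- The points `x`, `y`, `u`, `v` are distinct. Conjugating by the swap of `y` and `u` turns
      -- the pairs {x , u} and {y , v} of `τ` into {x , y} and {u , v} and keeps all others.
      w = transpose y u
      τ′ = w ∘ τ ∘ w

      w-inv : Involutive _≡_ w
      w-inv = transpose-involutive u≢y

      τ′-inv : Involutive _≡_ τ′
      τ′-inv a = trans (cong (w ∘ τ) (w-inv (τ (w a))))
                 (trans (cong w (τ-inv (w a))) (w-inv a))

      τ′-free : ∀ a → τ′ a ≢ a
      τ′-free a eq = τ-free (w a) (trans (sym (w-inv _)) (cong w eq))

      rec = separate xs τ′-inv τ′-free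

      b′ b : A → Bool
      b′ = proj₁ rec
      -- `x` and `y` get the opposites of the colors of `u` and `v`. Those differ because `τ′`
      -- matches `u` with `v`, so `x` and `y` differ too.
      b = update₂ x (not (b′ u)) y (not (b′ v)) b′

      b-x : b x ≡ not (b′ u)
      b-x = update₂-fst b′

      b-y : b y ≡ not (b′ v)
      b-y = update₂-snd b′ y≢x

      b-other : ∀ {a} → a ≢ x → a ≢ y → b a ≡ b′ a
      b-other = update₂-other b′

      b-u : b u ≡ b′ u
      b-u = b-other (τ-free x) u≢y

      b-v : b v ≡ b′ v
      b-v = b-other v≢x (τ-free y)

      τ′-u : τ′ u ≡ v
      τ′-u = trans (cong (w ∘ τ) (update₂-snd id u≢y)) (update₂-other id (τ-free y) v≢u)

      b-x≢y : b x ≢ b y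
      b-x≢y = ≢-resp b-x b-y
        (≢-resp refl (cong b′ (sym τ′-u)) (proj₁ (proj₂ rec) u) ∘ not-injective)

      b-xu : b x ≢ b u
      b-xu = ≢-resp b-x b-u (not-¬ refl ∘ sym)

      b-yv : b y ≢ b v
      b-yv = ≢-resp b-y b-v (not-¬ refl ∘ sym)

      b-τ : ∀ a → b a ≢ b (τ a)
      b-τ a = cases a (a ≟A x) (a ≟A y) (a ≟A u) (a ≟A v)
        where
        cases : ∀ a → Dec (a ≡ x) → Dec (a ≡ y) → Dec (a ≡ u) → Dec (a ≡ v) →
                b a ≢ b (τ a)
        cases _ (yes refl) _ _ _ = b-xu
        cases _ (no _) (yes refl) _ _ = b-yv
        cases _ (no _) (no _) (yes refl) _ = ≢-resp refl (cong b (τ-inv x)) (b-xu ∘ sym)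
        cases _ (no _) (no _) (no _) (yes refl) = ≢-resp refl (cong b (τ-inv y)) (b-yv ∘ sym)
        -- Away from the four points `τ′` agrees with `τ`, and neither `a` nor `τ a` was recolored.
        cases a (no a≢x) (no a≢y) (no a≢u) (no a≢v) =
          ≢-resp (b-other a≢x a≢y) (trans (b-other τa≢x τa≢y) (cong b′ (sym τ′-a)))
                 (proj₁ (proj₂ rec) a)
          where
          τa≢x : τ a ≢ x
          τa≢x eq = a≢u (trans (sym (τ-inv a)) (cong τ eq))

          τa≢y : τ a ≢ y
          τa≢y eq = a≢v (trans (sym (τ-inv a)) (cong τ eq))

          τ′-a : τ′ a ≡ τ a
          τ′-a = trans (cong (w ∘ τ) (update₂-other id a≢y a≢u))
                       (update₂-other id τa≢y (a≢x ∘ τ-injective))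

      b-σ : ∀ {a} → a ∈ᴸ x ∷ xs → σ a ≢ a → b a ≢ b (σ a)
      b-σ (here refl) _ = b-x≢y
      b-σ {a} (there a∈) moved = cases (a ≟A x) (a ≟A y)
        where
        cases : Dec (a ≡ x) → Dec (a ≡ y) → b a ≢ b (σ a)
        cases (yes refl) _ = b-x≢y
        cases (no _) (yes refl) = ≢-resp refl (cong b (σ-inv x)) (b-x≢y ∘ sym)
        -- `σ` maps {x , y} to itself, so the pair of `a` is disjoint from it and keeps its colors.
        cases (no a≢x) (no a≢y) = ≢-resp (b-other a≢x a≢y)
          (b-other (λ eq → a≢y (trans (sym (σ-inv a)) (cong σ eq)))
                   (a≢x ∘ involutive⇒injective σ σ-inv))
          (proj₂ (proj₂ rec) a∈ moved)

Separates : (A → Bool) → (A → A) → Set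
Separates b σ = ∀ a → σ a ≢ a → b a ≢ b (σ a)

-- On two copies of Fin n, matching the two copies of each fixed point of τ turns
-- τ into a fixed-point-free involution.
two-involutions : (σ τ : Fin n → Fin n) → Involutive _≡_ σ → Involutive _≡_ τ →
  ∃[ b ] Separates b σ × Separates b τ
two-involutions {n} σ τ σ-inv τ-inv =
  let b , b-τ , b-σ = separate (≡-dec _≟_ _≟_) code code-injective σ² σ²-inv
                        (cartesianProduct (allFin n) (allFin 2)) τ²-inv τ²-free
  -- Copy `zero` suffices: `σ²` never leaves it, and `τ²` leaves it only at fixed points of `τ`.
  in (λ a → b (a , zero))
   , (λ a moved → b-σ (∈-cartesianProduct⁺ (∈-allFin a) (∈-allFin zero)) (moved ∘ cong proj₁))
   , (λ a moved → ≢-resp refl (cong b (sym (τ²-moved moved))) (b-τ (a , zero)))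
  where
  code : Fin n × Fin 2 → ℕ
  code (a , s) = toℕ (combine a s)

  code-injective : Injective _≡_ _≡_ code
  code-injective {a , s} {a′ , s′} eq =
    case combine-injective a s a′ s′ (toℕ-injective eq) of λ where
      (refl , refl) → refl

  σ² τ² : Fin n × Fin 2 → Fin n × Fin 2
  σ² (a , s) = σ a , s
  τ² (a , s) = τ a , (if does (τ a ≟ a) then opposite s else s)

  σ²-inv : Involutive _≡_ σ²
  σ²-inv (a , s) = cong (_, s) (σ-inv a)

  τ²-fixed : ∀ {a s} → τ a ≡ a → τ² (a , s) ≡ (a , opposite s)
  τ²-fixed {a} eq rewrite dec-true (τ a ≟ a) eq = cong (_, _) eq

  τ²-moved : ∀ {a s} → τ a ≢ a → τ² (a , s) ≡ (τ a , s)
  τ²-moved {a} ne rewrite dec-false (τ a ≟ a) ne = refl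

  τ²-inv : Involutive _≡_ τ²
  τ²-inv (a , s) with τ a ≟ a
  ... | yes eq = trans (cong (λ a′ → τ² (a′ , opposite s)) eq)
                 (trans (τ²-fixed eq) (cong (a ,_) (opposite-involutive s)))
  ... | no ne = trans (τ²-moved (ne ∘ involutive⇒injective τ τ-inv)) (cong (_, s) (τ-inv a))

  opposite-free : (s : Fin 2) → opposite s ≢ s
  opposite-free zero ()
  opposite-free (suc zero) ()

  τ²-free : ∀ p → τ² p ≢ p
  τ²-free (a , s) with τ a ≟ a
  ... | yes _ = opposite-free s ∘ cong proj₂
  ... | no ne = ne ∘ cong proj₁

-- Partial matchings as involutions

module _ {_~_ : Rel (Fin n) 0ℓ} (_~?_ : Decidable _~_) (~-sym : Symmetric _~_)
         (~-unique : ∀ {a b c} → a ~ b → a ~ c → b ≡ c) where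

  -- Unmatched points become fixed points, which `Separates` exempts; this makes a partial matching
  -- a total involution.
  partner : Fin n → Fin n
  partner a with any? (a ~?_)
  ... | yes (b , _) = b
  ... | no _ = a

  partner-≡ : ∀ {a b} → a ~ b → partner a ≡ b
  partner-≡ {a} a~b with any? (a ~?_)
  ... | yes (_ , a~c) = ~-unique a~c a~b
  ... | no none = contradiction (_ , a~b) none

  partner-fixed : ∀ {a} → ¬ (∃ λ b → a ~ b) → partner a ≡ a
  partner-fixed {a} none with any? (a ~?_)
  ... | yes some = contradiction some none
  ... | no _ = refl

  partner-involutive : Involutive _≡_ partner
  partner-involutive a with any? (a ~?_)
  ... | yes (_ , a~b) = partner-≡ (~-sym a~b)
  ... | no none = partner-fixed none

-- Clique relations and proper colorings

-- A partial equivalence relation on Fin n whose classes have at most k elements;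
-- points outside every clique are not related even to themselves.
record CliqueRelation (k n : ℕ) : Set₁ where
  field
    _∼_     : Rel (Fin n) 0ℓ
    _∼?_    : Decidable _∼_
    ∼-sym   : Symmetric _∼_
    ∼-trans : Transitive _∼_
    bounded : {h : Fin (ℕ.suc k) → Fin n} → Injective _≡_ _≡_ h →
              ¬ (∀ i → h zero ∼ h (suc i))

  Proper : {C : Set} → (Fin n → C) → Set
  Proper c = ∀ i j → i ∼ j → c i ≡ c j → i ≡ j

open CliqueRelation using (Proper)

restrict : CliqueRelation k (ℕ.suc n) → CliqueRelation k n
restrict R = record
  { _∼_     = λ i j → suc i ∼ suc j
  ; _∼?_    = λ i j → suc i ∼? suc j
  ; ∼-sym   = ∼-sym
  ; ∼-trans = ∼-trans
  ; bounded = λ inj → bounded (inj ∘ suc-injective)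
  }
  where open CliqueRelation R

_◂_ : A → (Fin n → A) → Fin (ℕ.suc n) → A
(a ◂ c) zero = a
(a ◂ c) (suc i) = c i

-- If every color occurred on some point related to `zero`, these `k` points, distinct because their
-- colors are, would together with `zero` contradict `bounded`.
extend : (R : CliqueRelation k (ℕ.suc n)) {c : Fin n → Fin k} →
  Proper (restrict R) c → ∃[ α ] Proper R (α ◂ c)
extend {k} R {c} proper = case any? free? of λ where
    (yes (α , free)) → α , λ where
      zero    zero    _ _ → refl
      zero    (suc j) z∼j α≡ → contradiction (z∼j , sym α≡) (free j)
      (suc i) zero    i∼z ≡α → contradiction (∼-sym i∼z , ≡α) (free i)
      (suc i) (suc j) i∼j eq → cong suc (proper i j i∼j eq)
    (no none) →
      contradiction (λ α → decidable-stable (any? (used? α)) λ unused →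
                             none (α , λ i at → unused (i , at)))
                    someFree
  where
  open CliqueRelation R

  used? : ∀ α i → Dec (zero ∼ suc i × c i ≡ α)
  used? α i = (zero ∼? suc i) ×-dec (c i ≟ α)

  someFree : ¬ (∀ α → ∃[ i ] zero ∼ suc i × c i ≡ α)
  someFree used = bounded h-injective (proj₁ ∘ proj₂ ∘ used)
    where
    h : Fin (ℕ.suc k) → Fin _
    h = zero ◂ (suc ∘ proj₁ ∘ used)

    h-injective : Injective _≡_ _≡_ h
    h-injective {zero} {zero} _ = refl
    h-injective {suc α} {suc β} eq = cong suc (trans (sym (proj₂ (proj₂ (used α))))
      (trans (cong c (suc-injective eq)) (proj₂ (proj₂ (used β)))))

  free? : ∀ α → Dec (∀ i → ¬ (zero ∼ suc i × c i ≡ α))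
  free? α = all? (λ i → ¬? (used? α i))

-- Kempe changes and König's edge coloring theorem

module Kempe {k} {α β : Fin k} (α≢β : α ≢ β) where

  OnChain : Fin k → Set
  OnChain γ = γ ≡ α ⊎ γ ≡ β

  onChain? : ∀ γ → Dec (OnChain γ)
  onChain? γ = (γ ≟ α) ⊎-dec (γ ≟ β)

  third : ∀ {γ δ ε} → OnChain γ → OnChain δ → OnChain ε → γ ≢ δ → γ ≢ ε → δ ≡ ε
  third (inj₁ refl) (inj₁ refl) _ ne _ = contradiction refl ne
  third (inj₁ refl) (inj₂ _) (inj₁ refl) _ ne = contradiction refl ne
  third (inj₁ refl) (inj₂ refl) (inj₂ refl) _ _ = refl
  third (inj₂ refl) (inj₂ refl) _ ne _ = contradiction refl ne
  third (inj₂ refl) (inj₁ _) (inj₂ refl) _ ne = contradiction refl ne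
  third (inj₂ refl) (inj₁ refl) (inj₁ refl) _ _ = refl

  pick : Bool → Fin k
  pick true = α
  pick false = β

  pick-injective : Injective _≡_ _≡_ pick
  pick-injective {true} {true} _ = refl
  pick-injective {false} {false} _ = refl
  pick-injective {true} {false} eq = contradiction eq α≢β
  pick-injective {false} {true} eq = contradiction (sym eq) α≢β

  pick-onChain : ∀ s → OnChain (pick s)
  pick-onChain true = inj₁ refl
  pick-onChain false = inj₂ refl

  recolor : (A → Bool) → (A → Fin k) → A → Fin k
  recolor b c i = if does (onChain? (c i)) then pick (b i) else c i

  module _ (b : A → Bool) (c : A → Fin k) {i : A} where

    recolor-on : OnChain (c i) → recolor b c i ≡ pick (b i)
    recolor-on on rewrite dec-true (onChain? (c i)) on = refl

    recolor-off : ¬ OnChain (c i) → recolor b c i ≡ c i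
    recolor-off off rewrite dec-false (onChain? (c i)) off = refl

  module _ (R : CliqueRelation k n) {c : Fin n → Fin k} (proper : Proper R c) where
    open CliqueRelation R hiding (Proper)

    _~_ : Rel (Fin n) 0ℓ
    i ~ j = i ∼ j × i ≢ j × OnChain (c i) × OnChain (c j)

    _~?_ : Decidable _~_
    i ~? j = (i ∼? j) ×-dec ¬? (i ≟ j) ×-dec onChain? (c i) ×-dec onChain? (c j)

    ~-sym : Symmetric _~_
    ~-sym (i∼j , i≢j , on-i , on-j) = ∼-sym i∼j , i≢j ∘ sym , on-j , on-i

    -- Both `j` and `l` lie in the clique of `i` and avoid its color, so they share the other chain
    -- color, and properness identifies them.
    ~-unique : ∀ {i j l} → i ~ j → i ~ l → j ≡ l
    ~-unique (i∼j , i≢j , on-i , on-j) (i∼l , i≢l , _ , on-l) =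
      proper _ _ (∼-trans (∼-sym i∼j) i∼l)
        (third on-i on-j on-l (i≢j ∘ proper _ _ i∼j) (i≢l ∘ proper _ _ i∼l))

    mate : Fin n → Fin n
    mate = partner _~?_ ~-sym ~-unique

    mate-involutive : Involutive _≡_ mate
    mate-involutive = partner-involutive _~?_ ~-sym ~-unique

    -- Distinct chain points of one clique are mates, so `b` separates them. Recolored points stay
    -- within `α` and `β` and cannot collide with points off the chain.
    recolor-proper : ∀ {b} → Separates b mate → Proper R (recolor b c)
    recolor-proper {b} sep i j i∼j eq = cases (onChain? (c i)) (onChain? (c j))
      where
      cases : Dec (OnChain (c i)) → Dec (OnChain (c j)) → i ≡ j
      cases (no off-i) (no off-j) =
        proper i j i∼j (trans (sym (recolor-off b c off-i)) (trans eq (recolor-off b c off-j)))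
      cases (yes on) (no off) = contradiction
        (subst OnChain (trans (sym (recolor-on b c on)) (trans eq (recolor-off b c off)))
                       (pick-onChain (b i)))
        off
      cases (no off) (yes on) = contradiction
        (subst OnChain (trans (sym (recolor-on b c on)) (trans (sym eq) (recolor-off b c off)))
                       (pick-onChain (b j)))
        off
      cases (yes on-i) (yes on-j) = decidable-stable (i ≟ j) λ i≢j →
        let mate≡j = partner-≡ _~?_ ~-sym ~-unique (i∼j , i≢j , on-i , on-j)
            same-side = pick-injective
              (trans (sym (recolor-on b c on-i)) (trans eq (recolor-on b c on-j)))
        in sep i (λ fixed → i≢j (trans (sym fixed) mate≡j))
                 (trans same-side (cong b (sym mate≡j)))

  -- c₁ and c₂ give the new point different colors, each proper on one side only.
  kempe-change : (R₁ R₂ : CliqueRelation k n) {c₁ c₂ : Fin n → Fin k} →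
    Proper R₁ c₁ → Proper R₂ c₂ →
    (∀ i → c₁ i ≡ c₂ i ⊎ OnChain (c₁ i) × OnChain (c₂ i)) →
    ∃[ c ] Proper R₁ c × Proper R₂ c
  kempe-change R₁ R₂ {c₁} {c₂} proper₁ proper₂ agree =
    let b , sep₁ , sep₂ = two-involutions
                           (mate R₁ proper₁) (mate R₂ proper₂)
                           (mate-involutive R₁ proper₁) (mate-involutive R₂ proper₂)
        -- Where `c₁` and `c₂` differ, both colors are on the chain and the new color depends on `b`
        -- alone, so both recolorings are one coloring.
        same : ∀ i → recolor b c₁ i ≡ recolor b c₂ i
        same = λ i → case agree i of λ where
          (inj₁ eq) → cong (λ γ → if does (onChain? γ) then pick (b i) else γ) eq
          (inj₂ (on₁ , on₂)) → trans (recolor-on b c₁ on₁) (sym (recolor-on b c₂ on₂))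
    in recolor b c₁
     , recolor-proper R₁ proper₁ sep₁
     , λ i j i∼j eq → recolor-proper R₂ proper₂ sep₂ i j i∼j
         (trans (sym (same i)) (trans eq (same j)))

-- Induction on the number of points, with `zero` colored last. If the colors `α` and `β` free on
-- the two sides differ, the two extensions disagree only at `zero`, and a Kempe change reconciles
-- them.
könig : ∀ n (R₁ R₂ : CliqueRelation k n) →
  ∃[ c ] Proper R₁ {Fin k} c × Proper R₂ c
könig ℕ.zero R₁ R₂ = (λ ()) , (λ ()) , λ ()
könig (ℕ.suc n) R₁ R₂ =
  let c , proper₁ , proper₂ = könig n (restrict R₁) (restrict R₂)
      α , α-proper = extend R₁ proper₁
      β , β-proper = extend R₂ proper₂
  in case α ≟ β of λ where
    (yes α≡β) → α ◂ c , α-proper , subst (λ γ → Proper R₂ (γ ◂ c)) (sym α≡β) β-proper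
    (no α≢β) → Kempe.kempe-change α≢β R₁ R₂ α-proper β-proper λ where
      zero → inj₂ (inj₁ refl , inj₂ refl)
      (suc i) → inj₁ refl

-- Enumerating and counting subsets

nth : (K : Subset n) → Fin ∣ K ∣ → Fin n
nth (true ∷ K) zero = zero
nth (true ∷ K) (suc j) = suc (nth K j)
nth (false ∷ K) j = suc (nth K j)

nth-∈ : (K : Subset n) (j : Fin ∣ K ∣) → nth K j ∈ K
nth-∈ (true ∷ K) zero = here
nth-∈ (true ∷ K) (suc j) = there (nth-∈ K j)
nth-∈ (false ∷ K) j = there (nth-∈ K j)

nth-injective : (K : Subset n) → Injective _≡_ _≡_ (nth K)
nth-injective (true ∷ K) {zero} {zero} _ = refl
nth-injective (true ∷ K) {suc i} {suc j} eq = cong suc (nth-injective K (suc-injective eq))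
nth-injective (false ∷ K) eq = nth-injective K (suc-injective eq)

nth-surjective : {K : Subset n} {i : Fin n} → i ∈ K → ∃[ j ] nth K j ≡ i
nth-surjective here = zero , refl
nth-surjective {K = true ∷ K} (there i∈K) =
  let j , eq = nth-surjective i∈K in suc j , cong suc eq
nth-surjective {K = false ∷ K} (there i∈K) =
  let j , eq = nth-surjective i∈K in j , cong suc eq

-- A missed value could be punched out, leaving an injection into a set with one element fewer.
injective⇒surjective : {f : Fin n → Fin n} → Injective _≡_ _≡_ f → ∀ y → ∃[ x ] f x ≡ y
injective⇒surjective {n = ℕ.suc _} {f} inj y = decidable-stable (any? λ x → f x ≟ y) λ missed →
  let y≢f = λ x y≡fx → missed (x , sym y≡fx)
  in ℕ.1+n≰n (injective⇒≤ {f = λ x → punchOut (y≢f x)}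
       (λ {i} {j} eq → inj (punchOut-injective (y≢f i) (y≢f j) eq)))

-- As `K` has exactly `k` points, composing `c` with `nth K` gives an injective self-map of `Fin k`.
injectiveOn⇒surjective : (K : Subset n) → ∣ K ∣ ≡ k → {c : Fin n → Fin k} →
  (∀ {i j} → i ∈ K → j ∈ K → c i ≡ c j → i ≡ j) → ∀ γ → ∃[ i ] i ∈ K × c i ≡ γ
injectiveOn⇒surjective K refl inj γ =
  let j , eq = injective⇒surjective
                 (λ {i} {j} → nth-injective K ∘ inj (nth-∈ K i) (nth-∈ K j)) γ
  in nth K j , nth-∈ K j , eq

injective⇒≤∣∣ : (K : Subset n) {m : ℕ} {h : Fin m → Fin n} → Injective _≡_ _≡_ h →
  (∀ i → h i ∈ K) → m ℕ.≤ ∣ K ∣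
injective⇒≤∣∣ K inj h∈K = injective⇒≤ {f = proj₁ ∘ nth-surjective ∘ h∈K} λ {i} {j} eq →
  inj (trans (sym (proj₂ (nth-surjective (h∈K i))))
      (trans (cong (nth K) eq) (proj₂ (nth-surjective (h∈K j)))))

-- Disjoint cliques as a clique relation

Together : List (Subset n) → Rel (Fin n) 0ℓ
Together Ks i j = Any (λ K → i ∈ K × j ∈ K) Ks

-- By disjointness, the element occurring in both pairs lies in one clique only.
merge : {Ks : List (Subset n)} {P Q : Subset n → Set} {i : Fin n} →
  AllPairs Disjoint Ks → Any (λ K → i ∈ K × P K) Ks → Any (λ K → i ∈ K × Q K) Ks →
  Any (λ K → P K × Q K) Ks
merge _ (here (_ , p)) (here (_ , q)) = here (p , q)
merge (disj ∷ _) (here (i∈K , _)) (there qs) =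
  let _ , L∈ , i∈L , _ = find qs
  in contradiction (_ , x∈p∩q⁺ (i∈K , i∈L)) (All.lookup disj L∈)
merge (disj ∷ _) (there ps) (here (i∈K , _)) =
  let _ , L∈ , i∈L , _ = find ps
  in contradiction (_ , x∈p∩q⁺ (i∈K , i∈L)) (All.lookup disj L∈)
merge (_ ∷ disj) (there ps) (there qs) = there (merge disj ps qs)

together : .{{_ : NonZero k}} {Ks : List (Subset n)} →
  All (λ K → ∣ K ∣ ≡ k) Ks → AllPairs Disjoint Ks → CliqueRelation k n
together {k} {n} {Ks} sizes disj = record
  { _∼_     = Together Ks
  ; _∼?_    = λ i j → Any.any? (λ K → (i ∈? K) ×-dec (j ∈? K)) Ks
  ; ∼-sym   = Any.map swap
  ; ∼-trans = λ i∼j j∼l → merge disj (Any.map swap i∼j) j∼l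
  ; bounded = λ {h} inj h∼ →
      -- As `k` is positive, `h` has an index besides `zero`; its relation to `h zero` supplies the
      -- clique `K`, which then holds all `k + 1` values.
      let K , K∈ , h₀∈K , _ = find (h∼ (fromℕ< (ℕ.>-nonZero⁻¹ k)))
          h∈K : ∀ i → h i ∈ K
          h∈K = λ where
            zero → h₀∈K
            (suc i) → one-clique K∈ h₀∈K (h∼ i)
      in ℕ.1+n≰n (subst (_ ℕ.≤_) (All.lookup sizes K∈) (injective⇒≤∣∣ K inj h∈K))
  }
  where
  one-clique : ∀ {K i j} → K ∈ᴸ Ks → i ∈ K → Together Ks i j → j ∈ K
  one-clique {K} K∈ i∈K i∼j =
    -- With equality to `K` as `P`, `merge` returns a clique containing `j` along with a proof that
    -- it is `K`.
    let _ , _ , K≡L , j∈L = find (merge {P = K ≡_} disj (lose K∈ (i∈K , refl)) i∼j)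
    in subst (_ ∈_) (sym K≡L) j∈L

-- Polychromatic colorings from hitting cliques

theorem2 : ∀ {r ℓ₁ ℓ₂} (𝓡₁ : Family r ℓ₁) (𝓡₂ : Family r ℓ₂)
    (k m : ℕ) .{{_ : NonZero k}} .{{_ : NonZero m}} →
    HittingCliques 𝓡₁ k m → HittingCliques 𝓡₂ k m →
    PolychromaticNumber≤ (𝓡₁ ∪ 𝓡₂) k m
theorem2 𝓡₁ 𝓡₂ k m hitting₁ hitting₂ = record
  { attained = m , ℕ.≤-refl , colorable
  ; bounds = λ where
      [ M ] (_ , least) → [ least m colorable ]
      ⊤⁺ never → contradiction colorable (never m)
  }
  where
  colorable : PolychromaticallyColorable (𝓡₁ ∪ 𝓡₂) k m
  colorable V _ =
    let Ks₁ , sizes₁ , disj₁ , hit₁ = hitting₁ V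
        Ks₂ , sizes₂ , disj₂ , hit₂ = hitting₂ V
        c , proper₁ , proper₂ = könig (size V) (together sizes₁ disj₁) (together sizes₂ disj₂)
        -- A hit hyperedge contains a whole clique, on which properness means injectivity and hence
        -- all `k` colors.
        rainbow : ∀ {Ks E} → All (λ K → ∣ K ∣ ≡ k) Ks →
                  (∀ i j → Together Ks i j → c i ≡ c j → i ≡ j) →
                  Any (_⊆ E) Ks → ∀ γ → ∃[ i ] i ∈ E × c i ≡ γ
        rainbow = λ sizes proper hit γ →
          let K , K∈ , K⊆E = find hit
              i , i∈K , eq = injectiveOn⇒surjective K (All.lookup sizes K∈)
                (λ i∈K j∈K → proper _ _ (lose K∈ (i∈K , j∈K))) γ
          in i , K⊆E i∈K , eq
    in c , λ where
      E (R , inj₁ R∈ , trace) → rainbow sizes₁ proper₁ (hit₁ E (R , R∈ , trace))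
      E (R , inj₂ R∈ , trace) → rainbow sizes₂ proper₂ (hit₂ E (R , R∈ , trace))
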